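{- For any statement $s$, state predicate $U$ and setoid trace predicate $P$, if $\{U\}\,s\,\{P\}$ is derivable in the trace-based Hoare logic, then for every state predicate $W$, $\{U\wedge W\}\,s\,\{\mathrm{Last}(\langle W\rangle\ast\ast P)\}$ is derivable in the state-based partial-correctness Hoare logic.
   Context: While statements: $s ::= x:=e \mid \mathsf{skip}\mid s_0;s_1\mid \mathsf{if}\ e\ \mathsf{then}\ s_t\ \mathsf{else}\ s_f\mid \mathsf{while}\ e\ \mathsf{do}\ s_t$; a state $\sigma$ assigns integers to variables, $[\![e]\!]\sigma$ is the value of $e$, $\sigma\models e$ means $e$ is true in $\sigma$. The metatheory is constructive. Traces are coinductive: $\langle\sigma\rangle$, and $\sigma::\tau$ for a trace $\tau$; bisimilarity $\approx$ is coinductive; $\mathit{hd}\langle\sigma\rangle=\mathit{hd}(\sigma::\tau)=\sigma$; $\tau\downarrow\sigma$ is inductive: $\langle\sigma\rangle\downarrow\sigma$, $\sigma::\tau\downarrow\sigma'$ if $\tau\downarrow\sigma'$. State predicates are arbitrary; trace predicates are setoid predicates (invariant under $\approx$); $\mathsf{true},\wedge,\neg,\exists$ are pointwise; $\models$ is entailment. $\langle U\rangle$ holds exactly of $\langle\sigma\rangle$ with $\sigma\models U$; $\mathrm{dup}(U)$ exactly of $\sigma::\langle\sigma\rangle$ with $\sigma\models U$; $U[x\mapsto e]$ exactly of $\sigma::\langle\sigma[x\mapsto[\![e]\!]\sigma]\rangle$ with $\sigma\models U$. $\mathrm{follows}_Q(\tau,\tau')$ is coinductive: $\mathrm{follows}_Q(\langle\sigma\rangle,\tau)$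 if $\mathit{hd}\,\tau=\sigma$ and $\tau\models Q$; $\mathrm{follows}_Q(\sigma::\tau,\sigma::\tau')$ if $\mathrm{follows}_Q(\tau,\tau')$. $\tau'\models P\ast\ast Q$ iff $\exists\tau$, $\tau\models P$ and $\mathrm{follows}_Q(\tau,\tau')$ (chains associate to the right). $P^{\dagger}$ is coinductive: $\tau\models P^{\dagger}$ if $\tau\models\langle\mathsf{true}\rangle$; $\tau'\models P^{\dagger}$ if $\exists\tau$, $\tau\models P$ and $\mathrm{follows}_{P^{\dagger}}(\tau,\tau')$. $\mathrm{Last}(P)$ is the state predicate holding of $\sigma$ iff some $\tau\models P$ has $\tau\downarrow\sigma$. The trace-based Hoare logic derives $\{U\}\,s\,\{P\}$ inductively by: $\{U\}\,x:=e\,\{U[x\mapsto e]\}$; $\{U\}\,\mathsf{skip}\,\{\langle U\rangle\}$; from $\{U\}\,s_0\,\{P\ast\ast\langle V\rangle\}$ and $\{V\}\,s_1\,\{Q\}$ infer $\{U\}\,s_0;s_1\,\{P\ast\ast Q\}$; from $\{e\wedge U\}\,s_t\,\{P\}$ and $\{\neg e\wedge U\}\,s_f\,\{P\}$ infer $\{U\}\,\mathsf{if}\ e\ \mathsf{then}\ s_t\ \mathsf{else}\ s_f\,\{\mathrm{dup}(U)\ast\ast P\}$; from $U\models I$ and $\{e\wedge I\}\,s_t\,\{P\ast\ast\langle I\rangle\}$ infer $\{U\}\,\mathsf{while}\ e\ \mathsf{do}\ s_t\,\{\mathrm{dup}(U)\ast\ast(P\ast\ast\mathrm{dup}(I))^{\dagger}\ast\ast\langle\neg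 e\rangle\}$; from $U\models U'$, $\{U'\}\,s\,\{P'\}$, $P'\models P$ infer $\{U\}\,s\,\{P\}$; from $\forall z.\ \{U_z\}\,s\,\{P_z\}$ infer $\{\exists z.U_z\}\,s\,\{\exists z.P_z\}$. The state-based partial-correctness Hoare logic derives $\{U\}\,s\,\{Z\}$ inductively by: $\{U[e/x]\}\,x:=e\,\{U\}$ where $U[e/x]$ holds of $\sigma$ iff $U$ holds of $\sigma[x\mapsto[\![e]\!]\sigma]$; $\{U\}\,\mathsf{skip}\,\{U\}$; from $\{U\}\,s_0\,\{V\}$, $\{V\}\,s_1\,\{Z\}$ infer $\{U\}\,s_0;s_1\,\{Z\}$; from $\{e\wedge U\}\,s_t\,\{Z\}$, $\{\neg e\wedge U\}\,s_f\,\{Z\}$ infer $\{U\}\,\mathsf{if}\ e\ \mathsf{then}\ s_t\ \mathsf{else}\ s_f\,\{Z\}$; from $\{e\wedge I\}\,s_t\,\{I\}$ infer $\{I\}\,\mathsf{while}\ e\ \mathsf{do}\ s_t\,\{I\wedge\neg e\}$; from $\forall z.\{U_z\}\,s\,\{V_z\}$ infer $\{\exists z.U_z\}\,s\,\{\exists z.V_z\}$; from $U\models U'$, $\{U'\}\,s\,\{Z'\}$, $Z'\models Z$ infer $\{U\}\,s\,\{Z\}$. -}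

module Defs where

open import Level using (Level; Lift; lift) renaming (suc to lsuc; zero to lzero)
open import Data.Nat using (ℕ; zero; suc; _≡ᵇ_)
open import Data.Integer using (ℤ; 0ℤ) renaming (_+_ to _+ℤ_; _-_ to _-ℤ_; _*_ to _*ℤ_)
open import Data.Bool using (Bool; true; false) renaming (if_then_else_ to ifᵇ_then_else_)
open import Data.Product using (Σ; _×_; _,_)
open import Data.Empty using (⊥)
open import Data.Sum using (_⊎_; inj₁; inj₂)
open import Relation.Nullary using (¬_)
open import Relation.Binary.PropositionalEquality using (_≡_; refl; sym; trans; cong; subst)

import Data.Unit
import Data.Unit.Polymorphic

Var : Set
Var = ℕ

data Expr : Set where
  num   : ℤ → Expr
  var   : Var → Expr
  plus  : Expr → Expr → Expr
  minus : Expr → Expr → Expr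
  times : Expr → Expr → Expr

data Stmt : Set where
  _≔_   : Var → Expr → Stmt
  skip  : Stmt
  _⨾_   : Stmt → Stmt → Stmt
  if_then_else_ : Expr → Stmt → Stmt → Stmt
  while_loop_ : Expr → Stmt → Stmt

State : Set
State = Var → ℤ

_[_↦_] : State → Var → ℤ → State
(σ [ x ↦ v ]) y = ifᵇ x ≡ᵇ y then v else σ y

⟦_⟧ : Expr → State → ℤ
⟦ num n ⟧ σ = n
⟦ var x ⟧ σ = σ x
⟦ plus e₁ e₂ ⟧ σ = ⟦ e₁ ⟧ σ +ℤ ⟦ e₂ ⟧ σ
⟦ minus e₁ e₂ ⟧ σ = ⟦ e₁ ⟧ σ -ℤ ⟦ e₂ ⟧ σ
⟦ times e₁ e₂ ⟧ σ = ⟦ e₁ ⟧ σ *ℤ ⟦ e₂ ⟧ σ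

SPred : Set₂
SPred = State → Set₁

Holds : Expr → SPred
Holds e σ = Lift (lsuc lzero) (¬ (⟦ e ⟧ σ ≡ 0ℤ))

trueˢ : SPred
trueˢ _ = Data.Unit.Polymorphic.⊤

_∧ˢ_ : SPred → SPred → SPred
(U ∧ˢ V) σ = U σ × V σ

¬ˢ_ : SPred → SPred
(¬ˢ U) σ = ¬ U σ

_⊨ˢ_ : SPred → SPred → Set₁
U ⊨ˢ V = ∀ σ → U σ → V σ

-- Possibly infinite, nonempty traces.
-- (Coinductive types are unavailable: --guardedness is not permitted.)
-- A trace is represented by its sequence of states together with a flag
-- per position telling whether that position is the last one.  Entries
-- after the first 'true' flag are irrelevant (everything below is
-- invariant under bisimilarity, which ignores them).
--   stop τ 0 ≡ true  : τ is ⟨ hd τ ⟩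
--   stop τ 0 ≡ false : τ is hd τ ∷ tl τ

record Trace : Set where
  constructor mkTrace
  field
    at   : ℕ → State
    stop : ℕ → Bool

open Trace public

hd : Trace → State
hd τ = at τ 0

tl : Trace → Trace
tl τ = mkTrace (λ n → at τ (suc n)) (λ n → stop τ (suc n))

⟨_⟩ : State → Trace
⟨ σ ⟩ = mkTrace (λ _ → σ) (λ _ → true)

_∷_ : State → Trace → Trace
σ ∷ τ = mkTrace f g
  where
  f : ℕ → State
  f zero = σ
  f (suc n) = at τ n
  g : ℕ → Bool
  g zero = false
  g (suc n) = stop τ n

-- One unfolding step of the coinductive definition
--   ⟨σ⟩ ≈ ⟨σ⟩ ;   σ ∷ τ ≈ σ ∷ τ'  if  τ ≈ τ'
-- and ≈ is its greatest fixed point, which (the functor being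
-- ω-continuous) is the intersection of the finite approximants.

BisF : (Trace → Trace → Set) → Trace → Trace → Set
BisF R τ τ' = hd τ ≡ hd τ' ×
  ((stop τ 0 ≡ true × stop τ' 0 ≡ true)
   ⊎ (stop τ 0 ≡ false × stop τ' 0 ≡ false × R (tl τ) (tl τ')))

Approx : ℕ → Trace → Trace → Set
Approx zero _ _ = Data.Unit.⊤
Approx (suc n) = BisF (Approx n)

_≈_ : Trace → Trace → Set
τ ≈ τ' = ∀ n → Approx n τ τ'

unfold≈ : ∀ {τ τ'} → τ ≈ τ' → BisF _≈_ τ τ'
unfold≈ {τ} {τ'} p with p 1
... | h , inj₁ ends = h , inj₁ ends
... | h , inj₂ (f , f' , _) = h , inj₂ (f , f' , tail)
  where
  tail : tl τ ≈ tl τ'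
  tail n with p (suc n)
  ... | _ , inj₁ (t , _) = Data.Empty.⊥-elim (absurd f t)
    where
    absurd : ∀ {b : Bool} → b ≡ false → b ≡ true → ⊥
    absurd refl ()
  ... | _ , inj₂ (_ , _ , a) = a

private
  t≢f : ∀ {b : Bool} → b ≡ true → b ≡ false → ⊥
  t≢f refl ()

data _↓_ : Trace → State → Set where
  end  : ∀ {τ} → stop τ 0 ≡ true → τ ↓ hd τ
  next : ∀ {τ σ} → stop τ 0 ≡ false → tl τ ↓ σ → τ ↓ σ

record TPred : Set₂ where
  field
    pred : Trace → Set₁
    resp : ∀ {τ τ'} → τ ≈ τ' → pred τ → pred τ'

open TPred public

_⊨ᵗ_ : TPred → TPred → Set₁
P ⊨ᵗ Q = ∀ τ → pred P τ → pred Q τ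

∃ᵗ : {Z : Set₁} → (Z → TPred) → TPred
pred (∃ᵗ {Z} P) τ = Σ Z λ z → pred (P z) τ
resp (∃ᵗ P) eq (z , p) = z , resp (P z) eq p

⟪_⟫ : SPred → TPred
pred ⟪ U ⟫ τ = stop τ 0 ≡ true × U (hd τ)
resp ⟪ U ⟫ eq (t , u) with unfold≈ eq
... | h , inj₁ (_ , t') = t' , subst U h u
... | h , inj₂ (f , _ , _) = Data.Empty.⊥-elim (t≢f t f)

-- dup(U) : exactly the traces σ ∷ ⟨σ⟩ with σ ⊨ U
dup : SPred → TPred
pred (dup U) τ = stop τ 0 ≡ false × U (hd τ) ×
                 stop (tl τ) 0 ≡ true × hd (tl τ) ≡ hd τ
resp (dup U) eq (f , u , t , h₁) with unfold≈ eq
... | h , inj₁ (t₀ , _) = Data.Empty.⊥-elim (t≢f t₀ f)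
... | h , inj₂ (_ , f' , eq') with unfold≈ eq'
...   | h' , inj₁ (_ , t') = f' , subst U h u , t' , trans (sym h') (trans h₁ h)
...   | h' , inj₂ (f₂ , _ , _) = Data.Empty.⊥-elim (t≢f t f₂)

-- U[x ↦ e] : exactly the traces σ ∷ ⟨σ[x ↦ ⟦e⟧σ]⟩ with σ ⊨ U
_[_≔_]ᵗ : SPred → Var → Expr → TPred
pred (U [ x ≔ e ]ᵗ) τ = stop τ 0 ≡ false × U (hd τ) ×
                        stop (tl τ) 0 ≡ true × hd (tl τ) ≡ hd τ [ x ↦ ⟦ e ⟧ (hd τ) ]
resp (U [ x ≔ e ]ᵗ) eq (f , u , t , h₁) with unfold≈ eq
... | h , inj₁ (t₀ , _) = Data.Empty.⊥-elim (t≢f t₀ f)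
... | h , inj₂ (_ , f' , eq') with unfold≈ eq'
...   | h' , inj₁ (_ , t') = f' , subst U h u , t' ,
          trans (sym h') (trans h₁ (cong (λ σ → σ [ x ↦ ⟦ e ⟧ σ ]) h))
...   | h' , inj₂ (f₂ , _ , _) = Data.Empty.⊥-elim (t≢f t f₂)

-- follows_Q (coinductive): greatest fixed point of the step
--   follows_Q(⟨σ⟩, τ)        if hd τ = σ and τ ⊨ Q
--   follows_Q(σ ∷ τ, σ ∷ τ') if follows_Q(τ, τ')
-- i.e. it holds iff it is contained in some post-fixed relation.

FolF : ∀ {ℓ} → (Trace → Set ℓ) → (Trace → Trace → Set) → Trace → Trace → Set ℓ
FolF Q S τ τ' =
  (stop τ 0 ≡ true × hd τ' ≡ hd τ × Q τ')
  ⊎ Data.Product.Σ (stop τ 0 ≡ false) (λ _ → stop τ' 0 ≡ false × hd τ ≡ hd τ' ×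
                     S (tl τ) (tl τ'))

Follows : ∀ {ℓ} → (Trace → Set ℓ) → Trace → Trace → Set (lsuc lzero Level.⊔ ℓ)
Follows Q τ τ' = Σ (Trace → Trace → Set) λ S →
  (∀ a b → S a b → FolF Q S a b) × S τ τ'

Follows-map : ∀ {ℓ ℓ'} (Q : Trace → Set ℓ) (Q' : Trace → Set ℓ') →
  (∀ {b c} → b ≈ c → Q b → Q' c) →
  ∀ {τ τ₁ τ₂} → Follows Q τ τ₁ → τ₁ ≈ τ₂ → Follows Q' τ τ₂
Follows-map Q Q' f {τ} {τ₁} {τ₂} (S , post , s) eq =
  S' , post' , (τ₁ , s , eq)
  where
  S' : Trace → Trace → Set
  S' a c = Σ Trace λ b → S a b × b ≈ c
  post' : ∀ a c → S' a c → FolF Q' S' a c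
  post' a c (b , sab , bc) with post a b sab | unfold≈ bc
  ... | inj₁ (t , h , q) | h' , _ = inj₁ (t , trans (sym h') h , f bc q)
  ... | inj₂ (f₁ , f₂ , h , s') | _ , inj₁ (t , _) = Data.Empty.⊥-elim (t≢f t f₂)
  ... | inj₂ (f₁ , f₂ , h , s') | h' , inj₂ (_ , f₃ , tbc) =
          inj₂ (f₁ , f₃ , trans h h' , (tl b , s' , tbc))

_**_ : TPred → TPred → TPred
pred (P ** Q) τ' = Σ Trace λ τ → pred P τ × Follows (pred Q) τ τ'
resp (P ** Q) eq (τ , p , fo) = τ , p , Follows-map (pred Q) (pred Q) (resp Q) fo eq

infixr 5 _**_

-- P † (coinductive): greatest fixed point of
--   τ ⊨ P†  if τ ⊨ ⟨true⟩ ;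
--   τ' ⊨ P† if ∃τ. τ ⊨ P and follows_{P†}(τ, τ')

DagF : TPred → (Trace → Set) → Trace → Set₁
DagF P R τ' = pred ⟪ trueˢ ⟫ τ' ⊎ (Σ Trace λ τ → pred P τ × Follows R τ τ')

Dagger : TPred → Trace → Set₁
Dagger P τ' = Σ (Trace → Set) λ R → (∀ τ → R τ → DagF P R τ) × R τ'

Dagger-resp : ∀ P {τ₁ τ₂} → τ₁ ≈ τ₂ → Dagger P τ₁ → Dagger P τ₂
Dagger-resp P {τ₁} eq (R , post , r) = R' , post' , (τ₁ , r , eq)
  where
  R' : Trace → Set
  R' c = Σ Trace λ b → R b × b ≈ c
  post' : ∀ c → R' c → DagF P R' c
  post' c (b , rb , bc) with post b rb
  ... | inj₁ t = inj₁ (resp ⟪ trueˢ ⟫ bc t)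
  ... | inj₂ (τ , p , fo) =
          inj₂ (τ , p , Follows-map R R' (λ {b'} {c'} e x → b' , x , e) fo bc)

_† : TPred → TPred
pred (P †) = Dagger P
resp (P †) = Dagger-resp P

infix 6 _†

Last : TPred → SPred
Last P σ = Σ Trace λ τ → pred P τ × τ ↓ σ

data ⊢ᵗ_⟦_⟧_ : SPred → Stmt → TPred → Set₂ where
  assignᵗ : ∀ {U x e} → ⊢ᵗ U ⟦ x ≔ e ⟧ (U [ x ≔ e ]ᵗ)
  skipᵗ   : ∀ {U} → ⊢ᵗ U ⟦ skip ⟧ ⟪ U ⟫
  seqᵗ    : ∀ {U V s₀ s₁ P Q} →
            ⊢ᵗ U ⟦ s₀ ⟧ (P ** ⟪ V ⟫) → ⊢ᵗ V ⟦ s₁ ⟧ Q →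
            ⊢ᵗ U ⟦ s₀ ⨾ s₁ ⟧ (P ** Q)
  ifᵗ     : ∀ {U e sₜ s_f P} →
            ⊢ᵗ (Holds e ∧ˢ U) ⟦ sₜ ⟧ P → ⊢ᵗ ((¬ˢ Holds e) ∧ˢ U) ⟦ s_f ⟧ P →
            ⊢ᵗ U ⟦ if e then sₜ else s_f ⟧ (dup U ** P)
  whileᵗ  : ∀ {U I e sₜ P} →
            U ⊨ˢ I → ⊢ᵗ (Holds e ∧ˢ I) ⟦ sₜ ⟧ (P ** ⟪ I ⟫) →
            ⊢ᵗ U ⟦ while e loop sₜ ⟧ (dup U ** (P ** dup I) † ** ⟪ ¬ˢ Holds e ⟫)
  conseqᵗ : ∀ {U U' s P' P} →
            U ⊨ˢ U' → ⊢ᵗ U' ⟦ s ⟧ P' → P' ⊨ᵗ P → ⊢ᵗ U ⟦ s ⟧ P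
  existsᵗ : ∀ {Z : Set₁} {U : Z → SPred} {s} {P : Z → TPred} →
            (∀ z → ⊢ᵗ U z ⟦ s ⟧ P z) →
            ⊢ᵗ (λ σ → Σ Z λ z → U z σ) ⟦ s ⟧ ∃ᵗ P

_[_/_]ˢ : SPred → Expr → Var → SPred
(U [ e / x ]ˢ) σ = U (σ [ x ↦ ⟦ e ⟧ σ ])

data ⊢ˢ_⟦_⟧_ : SPred → Stmt → SPred → Set₂ where
  assignˢ : ∀ {U x e} → ⊢ˢ (U [ e / x ]ˢ) ⟦ x ≔ e ⟧ U
  skipˢ   : ∀ {U} → ⊢ˢ U ⟦ skip ⟧ U
  seqˢ    : ∀ {U V Z s₀ s₁} →
            ⊢ˢ U ⟦ s₀ ⟧ V → ⊢ˢ V ⟦ s₁ ⟧ Z → ⊢ˢ U ⟦ s₀ ⨾ s₁ ⟧ Z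
  ifˢ     : ∀ {U Z e sₜ s_f} →
            ⊢ˢ (Holds e ∧ˢ U) ⟦ sₜ ⟧ Z → ⊢ˢ ((¬ˢ Holds e) ∧ˢ U) ⟦ s_f ⟧ Z →
            ⊢ˢ U ⟦ if e then sₜ else s_f ⟧ Z
  whileˢ  : ∀ {I e sₜ} →
            ⊢ˢ (Holds e ∧ˢ I) ⟦ sₜ ⟧ I →
            ⊢ˢ I ⟦ while e loop sₜ ⟧ (I ∧ˢ (¬ˢ Holds e))
  existsˢ : ∀ {Z : Set₁} {U V : Z → SPred} {s} →
            (∀ z → ⊢ˢ U z ⟦ s ⟧ V z) →
            ⊢ˢ (λ σ → Σ Z λ z → U z σ) ⟦ s ⟧ (λ σ → Σ Z λ z → V z σ)
  conseqˢ : ∀ {U U' s Z' Z} →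
            U ⊨ˢ U' → ⊢ˢ U' ⟦ s ⟧ Z' → Z' ⊨ˢ Z → ⊢ˢ U ⟦ s ⟧ Z

{-# OPTIONS --safe #-}
-- By induction on the trace derivation one proves the stronger, frame-indexed
-- claim  ∀ W. {U ∧ W} s {σ | some τ ⊨ P starts in a W-state and ends in σ}.
-- The frame carries what a rule needs about the part already executed: for
-- s₀ ; s₁ the postcondition of s₀ becomes the frame of s₁, for a conditional
-- the frame is U ∧ W.  For a loop the invariant is I together with: every
-- admissible remainder of the loop trace from the current state completes the
-- part already executed to a trace of the loop's postcondition.
module Submission where

open import Defs
open import Data.Bool using (Bool; true; false)
open import Data.Product using (Σ; _×_; _,_)
open import Data.Sum using (_⊎_; inj₁; inj₂)
open import Data.Empty using (⊥; ⊥-elim)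
open import Relation.Binary.PropositionalEquality using (_≡_; refl; sym; trans; subst)
import Data.Unit.Polymorphic as ⊤

stop-clash : ∀ {b : Bool} → b ≡ true → b ≡ false → ⊥
stop-clash refl ()

-- append d κ is τ with its last state σ replaced by κ; intended for hd κ ≡ σ.
append : ∀ {τ σ} → τ ↓ σ → Trace → Trace
append (end _) κ = κ
append (next {τ} _ d) κ = hd τ ∷ append d κ

append-↓ : ∀ {τ σ κ σ'} (d : τ ↓ σ) → κ ↓ σ' → append d κ ↓ σ'
append-↓ (end _) e = e
append-↓ (next _ d) e = next refl (append-↓ d e)

hd-append : ∀ {τ σ κ} (d : τ ↓ σ) → hd κ ≡ σ → hd (append d κ) ≡ hd τ
hd-append (end _) h = h
hd-append (next _ d) _ = refl

module _ {ℓ} {Q : Trace → Set ℓ} where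

  Follows-append : ∀ {τ σ κ} (d : τ ↓ σ) → hd κ ≡ σ → Q κ → Follows Q τ (append d κ)
  Follows-append {κ = κ} d h q = AppendedTo , post , (_ , d , h , refl)
    where
    AppendedTo : Trace → Trace → Set
    AppendedTo a b = Σ State λ σ → Σ (a ↓ σ) λ e → hd κ ≡ σ × b ≡ append e κ
    post : ∀ a b → AppendedTo a b → FolF Q AppendedTo a b
    post _ _ (_ , end t , h , refl) = inj₁ (t , h , q)
    post _ _ (σ , next f e , h , refl) = inj₂ (f , refl , refl , (σ , e , h , refl))

  Follows-⟨⟩ : ∀ {σ κ} → hd κ ≡ σ → Q κ → Follows Q ⟨ σ ⟩ κ
  Follows-⟨⟩ = Follows-append (end refl)

  Follows-∷ : ∀ {σ τ τ'} → Follows Q τ τ' → Follows Q (σ ∷ τ) (σ ∷ τ')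
  Follows-∷ {σ} {τ} {τ'} (S , post , s) = S′ , post′ , inj₂ (refl , refl)
    where
    S′ : Trace → Trace → Set
    S′ a b = S a b ⊎ (a ≡ σ ∷ τ × b ≡ σ ∷ τ')
    post′ : ∀ a b → S′ a b → FolF Q S′ a b
    post′ a b (inj₁ r) with post a b r
    ... | inj₁ ends = inj₁ ends
    ... | inj₂ (f , f' , h , r') = inj₂ (f , f' , h , inj₁ r')
    post′ _ _ (inj₂ (refl , refl)) = inj₂ (refl , refl , refl , inj₁ s)

  Follows-append⁺ : ∀ {τ σ κ κ'} (d : τ ↓ σ) → Follows Q κ κ' →
                    Follows Q (append d κ) (append d κ')
  Follows-append⁺ (end _) fo = fo
  Follows-append⁺ (next _ d) fo = Follows-∷ (Follows-append⁺ d fo)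

  Follows-hd : ∀ {τ τ'} → Follows Q τ τ' → hd τ ≡ hd τ'
  Follows-hd {τ} {τ'} (S , post , s) with post τ τ' s
  ... | inj₁ (_ , h , _) = sym h
  ... | inj₂ (_ , _ , h , _) = h

  Follows-mono : ∀ {ℓ'} {Q' : Trace → Set ℓ'} {τ τ'} →
                 (∀ κ → Q κ → Q' κ) → Follows Q τ τ' → Follows Q' τ τ'
  Follows-mono {Q' = Q'} m (S , post , s) = S , post′ , s
    where
    post′ : ∀ a b → S a b → FolF Q' S a b
    post′ a b r with post a b r
    ... | inj₁ (t , h , q) = inj₁ (t , h , m b q)
    ... | inj₂ step = inj₂ step

Follows-⟪⟫-↓ : ∀ {V τ τ' σ} → Follows (pred ⟪ V ⟫) τ τ' → τ' ↓ σ → τ ↓ σ × V σ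
Follows-⟪⟫-↓ {τ = τ} {τ'} (S , post , s) (end t') with post τ τ' s
... | inj₁ (t , h , _ , v) = subst (τ ↓_) (sym h) (end t) , v
... | inj₂ (_ , f' , _) = ⊥-elim (stop-clash t' f')
Follows-⟪⟫-↓ {τ = τ} {τ'} (S , post , s) (next f' d) with post τ τ' s
... | inj₁ (_ , _ , t' , _) = ⊥-elim (stop-clash t' f')
... | inj₂ (f , _ , _ , s') with Follows-⟪⟫-↓ (S , post , s') d
...   | e , v = next f e , v

Dagger-fold : ∀ {P R τ τ'} → (∀ κ → R κ → DagF P R κ) →
              pred P τ → Follows R τ τ' → Dagger P τ'
Dagger-fold {P} {R} {τ} {τ'} post p fo = R′ , post′ , inj₂ refl
  where
  R′ : Trace → Set
  R′ κ = R κ ⊎ κ ≡ τ'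
  post′ : ∀ κ → R′ κ → DagF P R′ κ
  post′ κ (inj₁ r) with post κ r
  ... | inj₁ ends = inj₁ ends
  ... | inj₂ (τ₀ , p₀ , fo₀) = inj₂ (τ₀ , p₀ , Follows-mono (λ _ → inj₁) fo₀)
  post′ _ (inj₂ refl) = inj₂ (τ , p , Follows-mono (λ _ → inj₁) fo)

Dagger-⟨⟩ : ∀ P σ → Dagger P ⟨ σ ⟩
Dagger-⟨⟩ P σ = (_≡ ⟨ σ ⟩) , (λ { _ refl → inj₁ (refl , ⊤.tt) }) , refl

LastFrom : SPred → TPred → SPred
LastFrom W P σ = Σ Trace λ τ → pred P τ × W (hd τ) × τ ↓ σ

LastFrom⇒Last : ∀ {W P} → LastFrom W P ⊨ˢ Last (⟪ W ⟫ ** P)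
LastFrom⇒Last _ (τ , p , w , d) = τ , (⟨ hd τ ⟩ , (refl , w) , Follows-⟨⟩ refl p) , d

LastFrom-⟪⟫ : ∀ {W P V} → LastFrom W (P ** ⟪ V ⟫) ⊨ˢ (V ∧ˢ LastFrom W P)
LastFrom-⟪⟫ {W} _ (τ , (τ₀ , p , fo) , w , d) with Follows-⟪⟫-↓ fo d
... | d₀ , v = v , (τ₀ , p , subst W (sym (Follows-hd fo)) w , d₀)

LastFrom-** : ∀ {W P Q} → LastFrom (LastFrom W P) Q ⊨ˢ LastFrom W (P ** Q)
LastFrom-** {W} _ (κ , q , (τ , p , w , d) , e) =
  append d κ , (τ , p , Follows-append d refl q) , subst W (sym (hd-append d refl)) w ,
  append-↓ d e

LastFrom-mono : ∀ {W P P'} → P ⊨ᵗ P' → LastFrom W P ⊨ˢ LastFrom W P'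
LastFrom-mono P⊨P' _ (τ , p , w , d) = τ , P⊨P' τ p , w , d

record ⊢ˡ_⟦_⟧_ (U : SPred) (s : Stmt) (P : TPred) : Set₂ where
  constructor framed
  field
    under : ∀ W → ⊢ˢ (U ∧ˢ W) ⟦ s ⟧ LastFrom W P

open ⊢ˡ_⟦_⟧_

assignˡ : ∀ {U x e} → ⊢ˡ U ⟦ x ≔ e ⟧ (U [ x ≔ e ]ᵗ)
assignˡ {U} {x} {e} = framed λ W → conseqˢ (pre {W}) assignˢ (λ _ z → z)
  where
  pre : ∀ {W} → (U ∧ˢ W) ⊨ˢ (LastFrom W (U [ x ≔ e ]ᵗ) [ e / x ]ˢ)
  pre σ (u , w) = σ ∷ ⟨ σ [ x ↦ ⟦ e ⟧ σ ] ⟩ , (refl , u , refl , refl) , w , next refl (end refl)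

skipˡ : ∀ {U} → ⊢ˡ U ⟦ skip ⟧ ⟪ U ⟫
skipˡ = framed λ W → conseqˢ (λ _ z → z) skipˢ (λ σ (u , w) → ⟨ σ ⟩ , (refl , u) , w , end refl)

seqˡ : ∀ {U V s₀ s₁ P Q} → ⊢ˡ U ⟦ s₀ ⟧ (P ** ⟪ V ⟫) → ⊢ˡ V ⟦ s₁ ⟧ Q →
       ⊢ˡ U ⟦ s₀ ⨾ s₁ ⟧ (P ** Q)
seqˡ {V = V} {P = P} {Q} ⊢s₀ ⊢s₁ = framed λ W →
  seqˢ (conseqˢ (λ _ z → z) (under ⊢s₀ W) (LastFrom-⟪⟫ {W} {P} {V}))
       (conseqˢ (λ _ z → z) (under ⊢s₁ (LastFrom W P)) (LastFrom-** {W} {P} {Q}))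

ifˡ : ∀ {U e sₜ s_f P} → ⊢ˡ (Holds e ∧ˢ U) ⟦ sₜ ⟧ P → ⊢ˡ ((¬ˢ Holds e) ∧ˢ U) ⟦ s_f ⟧ P →
      ⊢ˡ U ⟦ if e then sₜ else s_f ⟧ (dup U ** P)
ifˡ {U} {P = P} ⊢sₜ ⊢s_f = framed λ W →
  ifˢ (conseqˢ reassoc (under ⊢sₜ (U ∧ˢ W)) (post {W}))
      (conseqˢ reassoc (under ⊢s_f (U ∧ˢ W)) (post {W}))
  where
  reassoc : ∀ {C W : SPred} → (C ∧ˢ (U ∧ˢ W)) ⊨ˢ ((C ∧ˢ U) ∧ˢ (U ∧ˢ W))
  reassoc _ (c , u , w) = (c , u) , u , w
  post : ∀ {W} → LastFrom (U ∧ˢ W) P ⊨ˢ LastFrom W (dup U ** P)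
  post _ (τ , p , (u , w) , d) =
    hd τ ∷ τ , (hd τ ∷ ⟨ hd τ ⟩ , (refl , u , refl , refl) , Follows-∷ (Follows-⟨⟩ refl p)) ,
    w , next refl d

module _ {U I e sₜ P} (U⊨I : U ⊨ˢ I) (⊢sₜ : ⊢ˡ (Holds e ∧ˢ I) ⟦ sₜ ⟧ (P ** ⟪ I ⟫)) where

  private
    Rest : TPred
    Rest = (P ** dup I) † ** ⟪ ¬ˢ Holds e ⟫

    Whole : TPred
    Whole = dup U ** Rest

  Extendable : SPred → SPred
  Extendable W σ = ∀ κ → hd κ ≡ σ → pred Rest κ →
    Σ Trace λ τ → pred Whole τ × W (hd τ) × (∀ {σ'} → κ ↓ σ' → τ ↓ σ')

  Extendable-entry : ∀ {W} → (U ∧ˢ W) ⊨ˢ (I ∧ˢ Extendable W)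
  Extendable-entry σ (u , w) = U⊨I σ u , λ κ h rest →
    σ ∷ κ , (σ ∷ ⟨ σ ⟩ , (refl , u , refl , refl) , Follows-∷ (Follows-⟨⟩ h rest)) , w , next refl

  Extendable-exit : ∀ {W} → ((I ∧ˢ Extendable W) ∧ˢ (¬ˢ Holds e)) ⊨ˢ LastFrom W Whole
  Extendable-exit {W} σ ((_ , ext) , ¬e)
    with ext ⟨ σ ⟩ refl (⟨ σ ⟩ , Dagger-⟨⟩ (P ** dup I) σ , Follows-⟨⟩ refl (refl , ¬e))
  ... | τ , whole , w , ↓σ = τ , whole , w , ↓σ (end refl)

  -- One more iteration τ₀ ⊨ P is folded into the dagger in front of κ.
  Extendable-step : ∀ {W} → LastFrom (Extendable W) (P ** ⟪ I ⟫) ⊨ˢ (I ∧ˢ Extendable W)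
  Extendable-step {W} σ (τ , (τ₀ , p , fo) , ext , d) with Follows-⟪⟫-↓ fo d
  ... | d₀ , i = i , ext′
    where
    ext′ : Extendable W σ
    ext′ κ h (κ₀ , (R , post , r) , fo₀)
      with ext (append d₀ (σ ∷ κ)) (trans (hd-append d₀ refl) (Follows-hd fo))
               (append d₀ (σ ∷ κ₀) , dagger′ , Follows-append⁺ d₀ (Follows-∷ fo₀))
      where
      dagger′ : Dagger (P ** dup I) (append d₀ (σ ∷ κ₀))
      dagger′ = Dagger-fold {P ** dup I} {R} post
        (τ₀ , p , Follows-append d₀ refl (refl , i , refl , refl))
        (Follows-append⁺ d₀ (Follows-∷ (Follows-⟨⟩ (trans (Follows-hd fo₀) h) r)))
    ... | τ′ , whole , w , ↓σ = τ′ , whole , w , λ e → ↓σ (append-↓ d₀ (next refl e))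

  whileˡ : ⊢ˡ U ⟦ while e loop sₜ ⟧ Whole
  whileˡ = framed λ W → conseqˢ Extendable-entry
    (whileˢ (conseqˢ (λ _ (he , i , ext) → (he , i) , ext) (under ⊢sₜ (Extendable W))
                     (Extendable-step {W})))
    (Extendable-exit {W})

conseqˡ : ∀ {U U' s P' P} → U ⊨ˢ U' → ⊢ˡ U' ⟦ s ⟧ P' → P' ⊨ᵗ P → ⊢ˡ U ⟦ s ⟧ P
conseqˡ {P' = P'} {P} U⊨U' ⊢s P'⊨P = framed λ W →
  conseqˢ (λ σ (u , w) → U⊨U' σ u , w) (under ⊢s W) (LastFrom-mono {W} {P'} {P} P'⊨P)

existsˡ : ∀ {Z : Set₁} {U : Z → SPred} {s} {P : Z → TPred} →
          (∀ z → ⊢ˡ U z ⟦ s ⟧ P z) → ⊢ˡ (λ σ → Σ Z λ z → U z σ) ⟦ s ⟧ ∃ᵗ P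
existsˡ ⊢s = framed λ W →
  conseqˢ (λ { _ ((z , u) , w) → z , u , w }) (existsˢ (λ z → under (⊢s z) W))
          (λ { _ (z , τ , p , w , d) → τ , (z , p) , w , d })

⊢ᵗ⇒⊢ˡ : ∀ {U s P} → ⊢ᵗ U ⟦ s ⟧ P → ⊢ˡ U ⟦ s ⟧ P
⊢ᵗ⇒⊢ˡ assignᵗ = assignˡ
⊢ᵗ⇒⊢ˡ skipᵗ = skipˡ
⊢ᵗ⇒⊢ˡ (seqᵗ {V = V} {P = P} ⊢s₀ ⊢s₁) = seqˡ {V = V} {P = P} (⊢ᵗ⇒⊢ˡ ⊢s₀) (⊢ᵗ⇒⊢ˡ ⊢s₁)
⊢ᵗ⇒⊢ˡ (ifᵗ ⊢sₜ ⊢s_f) = ifˡ (⊢ᵗ⇒⊢ˡ ⊢sₜ) (⊢ᵗ⇒⊢ˡ ⊢s_f)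
⊢ᵗ⇒⊢ˡ (whileᵗ {P = P} U⊨I ⊢sₜ) = whileˡ {P = P} U⊨I (⊢ᵗ⇒⊢ˡ ⊢sₜ)
⊢ᵗ⇒⊢ˡ (conseqᵗ U⊨U' ⊢s P'⊨P) = conseqˡ U⊨U' (⊢ᵗ⇒⊢ˡ ⊢s) P'⊨P
⊢ᵗ⇒⊢ˡ (existsᵗ ⊢s) = existsˡ (λ z → ⊢ᵗ⇒⊢ˡ (⊢s z))

proposition4p4 : ∀ {s U P} → ⊢ᵗ U ⟦ s ⟧ P →
    ∀ (W : SPred) → ⊢ˢ (U ∧ˢ W) ⟦ s ⟧ Last (⟪ W ⟫ ** P)
proposition4p4 {P = P} ⊢s W = conseqˢ (λ _ z → z) (under (⊢ᵗ⇒⊢ˡ ⊢s) W) (LastFrom⇒Last {W} {P})
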